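{- The class of $(P_6,\overline{2P_1+P_2})$-free graphs has unbounded clique-width.
   Context: All graphs are finite, simple and undirected. For a family of graphs $\{H_1,\ldots,H_p\}$, a graph $G$ is $(H_1,\ldots,H_p)$-free if no induced subgraph of $G$ is isomorphic to any $H_i$. $P_r$ denotes the path on $r$ vertices; $G+H$ is the disjoint union of $G$ and $H$, $sG$ is the disjoint union of $s$ copies of $G$; $\overline{G}$ denotes the complement of $G$ (so $\overline{2P_1+P_2}$ is the diamond, $K_4$ minus an edge). The clique-width of a graph $G$ is the minimum number of labels needed to construct $G$ using the operations: create a single vertex with label $i$; take the disjoint union of two labelled graphs; add all edges between vertices labelled $i$ and vertices labelled $j$ ($i\neq j$); rename label $i$ to $j$. A class of graphs has bounded clique-width if there is a constant $c$ such that every graph in the class has clique-width at most $c$, and unbounded clique-width otherwise. -}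

module Defs where

open import Data.Nat using (ℕ; zero; suc; _+_; _≡ᵇ_)
open import Data.Fin using (Fin; toℕ; splitAt; _≟_)
open import Data.Bool using (Bool; true; false; _∧_; _∨_; not)
open import Data.Bool.Properties using (∨-comm; ∧-comm)
open import Data.Sum using (_⊎_; inj₁; inj₂)
open import Data.Product using (Σ; _×_; _,_; ∃)
open import Relation.Nullary using (¬_; yes; no)
open import Relation.Nullary.Decidable using (⌊_⌋)
open import Relation.Binary.PropositionalEquality using (_≡_; _≢_; refl; sym; cong)
open import Function.Definitions using (Injective)
open import Function.Bundles using (_⤖_; Bijection)

record Graph : Set where
  field
    n      : ℕ
    adj    : Fin n → Fin n → Bool
    adj-sym    : ∀ x y → adj x y ≡ adj y x
    adj-irrefl : ∀ x → adj x x ≡ false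
open Graph public

_==_ : ∀ {m} → Fin m → Fin m → Bool
x == y = ⌊ x ≟ y ⌋

==-sym : ∀ {m} (x y : Fin m) → (x == y) ≡ (y == x)
==-sym x y with x ≟ y | y ≟ x
... | yes _ | yes _ = refl
... | no _  | no _  = refl
... | yes p | no q  = Data.Empty.⊥-elim (q (sym p)) where import Data.Empty
... | no p  | yes q = Data.Empty.⊥-elim (p (sym q)) where import Data.Empty

==-refl : ∀ {m} (x : Fin m) → (x == x) ≡ true
==-refl x with x ≟ x
... | yes _ = refl
... | no p  = Data.Empty.⊥-elim (p refl) where import Data.Empty

private
  succ≢ : ∀ k → (suc k ≡ᵇ k) ≡ false
  succ≢ zero = refl
  succ≢ (suc k) = succ≢ k

P : ℕ → Graph
P r = record
  { n = r
  ; adj = λ i j → (suc (toℕ i) ≡ᵇ toℕ j) ∨ (suc (toℕ j) ≡ᵇ toℕ i)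
  ; adj-sym = λ i j → ∨-comm (suc (toℕ i) ≡ᵇ toℕ j) (suc (toℕ j) ≡ᵇ toℕ i)
  ; adj-irrefl = λ i → irr (toℕ i)
  }
  where
  irr : ∀ k → ((suc k ≡ᵇ k) ∨ (suc k ≡ᵇ k)) ≡ false
  irr k rewrite succ≢ k = refl

private
  sumAdj : ∀ {a b} → (Fin a → Fin a → Bool) → (Fin b → Fin b → Bool)
         → Fin a ⊎ Fin b → Fin a ⊎ Fin b → Bool
  sumAdj f g (inj₁ x) (inj₁ y) = f x y
  sumAdj f g (inj₂ x) (inj₂ y) = g x y
  sumAdj f g (inj₁ x) (inj₂ y) = false
  sumAdj f g (inj₂ x) (inj₁ y) = false

_⊕_ : Graph → Graph → Graph
G ⊕ H = record
  { n = n G + n H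
  ; adj = λ x y → sumAdj (adj G) (adj H) (splitAt (n G) x) (splitAt (n G) y)
  ; adj-sym = λ x y → s (splitAt (n G) x) (splitAt (n G) y)
  ; adj-irrefl = λ x → i (splitAt (n G) x)
  }
  where
  s : ∀ u v → sumAdj (adj G) (adj H) u v ≡ sumAdj (adj G) (adj H) v u
  s (inj₁ x) (inj₁ y) = adj-sym G x y
  s (inj₂ x) (inj₂ y) = adj-sym H x y
  s (inj₁ x) (inj₂ y) = refl
  s (inj₂ x) (inj₁ y) = refl
  i : ∀ u → sumAdj (adj G) (adj H) u u ≡ false
  i (inj₁ x) = adj-irrefl G x
  i (inj₂ x) = adj-irrefl H x

complement : Graph → Graph
complement G = record
  { n = n G
  ; adj = λ x y → not (adj G x y) ∧ not (x == y)
  ; adj-sym = λ x y → s x y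
  ; adj-irrefl = λ x → i x
  }
  where
  s : ∀ x y → (not (adj G x y) ∧ not (x == y)) ≡ (not (adj G y x) ∧ not (y == x))
  s x y rewrite adj-sym G x y | ==-sym x y = refl
  i : ∀ x → (not (adj G x x) ∧ not (x == x)) ≡ false
  i x rewrite ==-refl x = ∧-comm (not (adj G x x)) false

diamond : Graph
diamond = complement ((P 1 ⊕ P 1) ⊕ P 2)

InducedSub : Graph → Graph → Set
InducedSub H G =
  Σ (Fin (n H) → Fin (n G)) λ f →
    Injective _≡_ _≡_ f × (∀ x y → adj G (f x) (f y) ≡ adj H x y)

Free : Graph → Graph → Set
Free H G = ¬ InducedSub H G

Iso : Graph → Graph → Set
Iso G H =
  Σ (Fin (n G) ⤖ Fin (n H)) λ b →
    ∀ x y → adj H (Bijection.to b x) (Bijection.to b y) ≡ adj G x y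

-- Clique-width via k-expressions (labels Fin k); an expression of type
-- Expr k m builds a labelled graph on vertex set Fin m.

data Expr (k : ℕ) : ℕ → Set where
  ∅       : Expr k 0
  vertex  : Fin k → Expr k 1
  union   : ∀ {a b} → Expr k a → Expr k b → Expr k (a + b)
  join    : ∀ {m} (i j : Fin k) → i ≢ j → Expr k m → Expr k m
  relabel : ∀ {m} (i j : Fin k) → Expr k m → Expr k m

labels : ∀ {k m} → Expr k m → Fin m → Fin k
edges  : ∀ {k m} → Expr k m → Fin m → Fin m → Bool

labels (vertex i) _ = i
labels (union {a} e₁ e₂) x with splitAt a x
... | inj₁ u = labels e₁ u
... | inj₂ v = labels e₂ v
labels (join i j _ e) x = labels e x
labels (relabel i j e) x with labels e x == i
... | true  = j
... | false = labels e x

edges ∅ ()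
edges (vertex i) _ _ = false
edges (union {a} e₁ e₂) x y = go (splitAt a x) (splitAt a y)
  where
  go : _ → _ → Bool
  go (inj₁ u) (inj₁ v) = edges e₁ u v
  go (inj₂ u) (inj₂ v) = edges e₂ u v
  go _ _ = false
edges (join i j _ e) x y =
  edges e x y ∨ ((labels e x == i) ∧ (labels e y == j))
              ∨ ((labels e x == j) ∧ (labels e y == i))
edges (relabel i j e) x y = edges e x y

CWAtMost : ℕ → Graph → Set
CWAtMost k G =
  Σ (Expr k (n G)) λ e →
    Σ (Fin (n G) ⤖ Fin (n G)) λ b →
      ∀ x y → edges e (Bijection.to b x) (Bijection.to b y) ≡ adj G x y

UnboundedCW : (Graph → Set) → Set
UnboundedCW C = ∀ c → Σ Graph λ G → C G × ¬ CWAtMost c G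

{-# OPTIONS --safe #-}
module Submission where

-- Take rows r₁ … r_N, columns c₁ … c_N and N² cells, joining every row to every
-- column and cell (i , j) to rᵢ and cⱼ; that is, the subdivision of K_{N,N} with
-- the edges of K_{N,N} put back.  A cell is never the middle of an induced P₃, so
-- the four inner vertices of an induced P₆ would lie in the complete bipartite
-- graph on rows and columns, which has no induced P₄; and adjacent vertices have
-- at most one common neighbour, so there is no diamond.
--
-- In a k-expression, two equally labelled vertices of a subexpression with vertex
-- set X have the same neighbours outside X.  In the graph above this forces X to
-- contain at most k or at least N − k of the rows: if no row has all its cells in
-- X, then each row of X has a private neighbour outside X; if some row has, then
-- every column meets X, so (N > 2k) some column has all its cells in X, and each
-- row outside X is the private neighbour of a cell of that column.
-- A union of two sets with at most k rows has at most 2k < N − k of them, so when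
-- N > 3k no subexpression ever gets beyond k rows.

open import Defs
open import Data.Bool using (Bool; true; false; _∧_; _∨_; if_then_else_) renaming (_≟_ to _≟ᵇ_)
open import Data.Empty using (⊥-elim)
open import Data.Fin using (Fin; zero; suc; _↑ˡ_; _↑ʳ_; splitAt; combine; remQuot; punchOut; _≟_)
open import Data.Fin.Patterns using (0F; 1F; 2F; 3F; 4F; 5F)
open import Data.Fin.Properties using (any?; all?; ¬∀⟶∃¬; punchOut-injective; suc-injective; splitAt-↑ˡ; splitAt-↑ʳ; splitAt⁻¹-↑ˡ; splitAt⁻¹-↑ʳ; remQuot-combine; combine-remQuot)
open import Data.Maybe using (Maybe; just; nothing; is-just; is-nothing; _>>=_) renaming (map to mapᴹ)
open import Data.Maybe.Properties using (just-injective)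
open import Data.Nat using (ℕ; zero; suc; _+_; _*_; _≤_; _<_; z≤n; s≤s)
open import Data.Nat.Properties using (≤-refl; ≤-trans; ≤-reflexive; +-mono-≤; +-monoˡ-≤; m≤m+n; m≤n+m; <⇒≱; n<1+n; +-suc)
open import Data.Product using (∃-syntax; _×_; _,_; proj₁; proj₂; uncurry)
open import Data.Sum using (_⊎_; inj₁; inj₂; isInj₁; isInj₂)
open import Function using (_∘_; const; id)
open import Function.Bundles using (Bijection)
open import Relation.Nullary using (¬_; yes; no; contradiction)
open import Relation.Binary.PropositionalEquality using (_≡_; _≢_; refl; sym; trans; cong; cong₂; subst)

-- Counting

count : ∀ {N} → (Fin N → Bool) → ℕ
count {zero}  p = 0
count {suc N} p = (if p zero then 1 else 0) + count (p ∘ suc)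

count-true : ∀ N → count {N} (const true) ≡ N
count-true zero    = refl
count-true (suc N) = cong suc (count-true N)

count-cong : ∀ {N} {p q : Fin N → Bool} → (∀ i → p i ≡ q i) → count p ≡ count q
count-cong {zero}  h = refl
count-cong {suc N} h = cong₂ (λ t c → (if t then 1 else 0) + c) (h zero) (count-cong (h ∘ suc))

-- Serves twice: the rows of a union lie in one of its operands, and every row or column is either
-- inside or outside a cut.
count-cover : ∀ {N} (p q r : Fin N → Bool) →
              (∀ i → p i ≡ true → q i ≡ true ⊎ r i ≡ true) →
              count p ≤ count q + count r
count-cover {zero}  p q r cov = z≤n
count-cover {suc N} p q r cov
  with p zero in pz | q zero in qz | r zero in rz | count-cover (p ∘ suc) (q ∘ suc) (r ∘ suc) (cov ∘ suc)
... | false | false | false | ih = ih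
... | false | false | true  | ih = ≤-trans ih (+-mono-≤ ≤-refl (m≤n+m _ 1))
... | false | true  | false | ih = ≤-trans ih (m≤n+m _ 1)
... | false | true  | true  | ih = ≤-trans ih (+-mono-≤ (m≤n+m _ 1) (m≤n+m _ 1))
... | true  | true  | false | ih = s≤s ih
... | true  | true  | true  | ih = s≤s (≤-trans ih (+-mono-≤ ≤-refl (m≤n+m _ 1)))
... | true  | false | true  | ih = ≤-trans (s≤s ih) (≤-reflexive (sym (+-suc _ _)))
... | true  | false | false | ih with cov zero pz
...   | inj₁ q≡t with () ← trans (sym qz) q≡t
...   | inj₂ r≡t with () ← trans (sym rz) r≡t

-- Pigeonhole: once index `zero` is counted, its value is punched out of `Fin k`, and the remaining
-- indices inject into one value fewer. `f` is required only where `p` holds, since only vertices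
-- inside a cut have a label.
count-injection : ∀ {N k} (p : Fin N → Bool) (f : ∀ i → p i ≡ true → Fin k) →
                  (∀ {i j} pi pj → f i pi ≡ f j pj → i ≡ j) → count p ≤ k
count-injection {zero} p f f-inj = z≤n
count-injection {suc N} {k} p f f-inj with p zero in pz
... | false = count-injection (p ∘ suc) (f ∘ suc) λ pi pj eq → suc-injective (f-inj pi pj eq)
count-injection {suc N} {zero}  p f f-inj | true with () ← f zero pz
count-injection {suc N} {suc k} p f f-inj | true =
  s≤s (count-injection (p ∘ suc) (λ i pi → punchOut (f₀≢ i pi))
        λ pi pj eq → suc-injective (f-inj pi pj (punchOut-injective (f₀≢ _ pi) (f₀≢ _ pj) eq)))
  where
  f₀≢ : ∀ i pi → f zero pz ≢ f (suc i) pi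
  f₀≢ i pi eq with () ← f-inj pz pi eq

-- Optional values and equality tests

is-just⇒just : ∀ {A : Set} (m : Maybe A) → is-just m ≡ true → ∃[ x ] m ≡ just x
is-just⇒just (just x) _ = x , refl

is-nothing⇒nothing : ∀ {A : Set} (m : Maybe A) → is-nothing m ≡ true → m ≡ nothing
is-nothing⇒nothing nothing _ = refl

is-just⊎is-nothing : ∀ {A : Set} (m : Maybe A) → is-just m ≡ true ⊎ is-nothing m ≡ true
is-just⊎is-nothing (just _) = inj₁ refl
is-just⊎is-nothing nothing  = inj₂ refl

≢true⇒nothing : ∀ {A : Set} (m : Maybe A) → ¬ (is-just m ≡ true) → m ≡ nothing
≢true⇒nothing (just _) h = ⊥-elim (h refl)
≢true⇒nothing nothing  _ = refl

map-just⁻¹ : ∀ {A B : Set} {f : A → B} (m : Maybe A) {y} → mapᴹ f m ≡ just y →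
             ∃[ x ] m ≡ just x × f x ≡ y
map-just⁻¹ (just x) eq = x , refl , just-injective eq

map-nothing⁻¹ : ∀ {A B : Set} {f : A → B} (m : Maybe A) → mapᴹ f m ≡ nothing → m ≡ nothing
map-nothing⁻¹ nothing _ = refl

is-just-map : ∀ {A B : Set} {f : A → B} (m : Maybe A) → is-just (mapᴹ f m) ≡ is-just m
is-just-map (just _) = refl
is-just-map nothing  = refl

==⇒≡ : ∀ {m} {x y : Fin m} → (x == y) ≡ true → x ≡ y
==⇒≡ {x = x} {y} eq with x ≟ y
... | yes x≡y = x≡y

-- The graph

data Vertex (N : ℕ) : Set where
  row col : Fin N → Vertex N
  cell    : Fin N → Fin N → Vertex N

module _ {N : ℕ} where

  adjᵛ : Vertex N → Vertex N → Bool
  adjᵛ (row _)    (col _)    = true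
  adjᵛ (col _)    (row _)    = true
  adjᵛ (row i)    (cell a _) = i == a
  adjᵛ (cell a _) (row i)    = a == i
  adjᵛ (col j)    (cell _ b) = j == b
  adjᵛ (cell _ b) (col j)    = b == j
  adjᵛ _          _          = false

  adjᵛ-sym : ∀ u v → adjᵛ u v ≡ adjᵛ v u
  adjᵛ-sym (row _)    (row _)    = refl
  adjᵛ-sym (row _)    (col _)    = refl
  adjᵛ-sym (row i)    (cell a _) = ==-sym i a
  adjᵛ-sym (col _)    (row _)    = refl
  adjᵛ-sym (col _)    (col _)    = refl
  adjᵛ-sym (col j)    (cell _ b) = ==-sym j b
  adjᵛ-sym (cell a _) (row i)    = ==-sym a i
  adjᵛ-sym (cell _ b) (col j)    = ==-sym b j
  adjᵛ-sym (cell _ _) (cell _ _) = refl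

  adjᵛ-irrefl : ∀ u → adjᵛ u u ≡ false
  adjᵛ-irrefl (row _)    = refl
  adjᵛ-irrefl (col _)    = refl
  adjᵛ-irrefl (cell _ _) = refl

  data IsLine : Vertex N → Set where
    row : ∀ i → IsLine (row i)
    col : ∀ j → IsLine (col j)

  -- The only neighbours of a cell are its row and its column, and these are adjacent, so a cell has
  -- no two distinct non-adjacent neighbours.
  middle-isLine : ∀ u v w → adjᵛ u v ≡ true → adjᵛ v w ≡ true →
                  adjᵛ u w ≡ false → u ≢ w → IsLine v
  middle-isLine _ (row i) _ _ _ _ _ = row i
  middle-isLine _ (col j) _ _ _ _ _ = col j
  middle-isLine (row i) (cell a b) (row i′) uv vw _ u≢w =
    ⊥-elim (u≢w (cong row (trans (==⇒≡ uv) (==⇒≡ vw))))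
  middle-isLine (col j) (cell a b) (col j′) uv vw _ u≢w =
    ⊥-elim (u≢w (cong col (trans (==⇒≡ uv) (==⇒≡ vw))))

  -- Rows and columns alternate along a path of lines, so the ends of a path on four lines are on
  -- opposite sides.
  lines-P₄-free : ∀ {u v w x} → IsLine u → IsLine v → IsLine w → IsLine x →
                  adjᵛ u v ≡ true → adjᵛ v w ≡ true → adjᵛ w x ≡ true → adjᵛ u x ≡ true
  lines-P₄-free (row _) (col _) (row _) (col _) _ _ _ = refl
  lines-P₄-free (col _) (row _) (col _) (row _) _ _ _ = refl

  -- Every triangle consists of a row, a column and the cell where they cross, and any two of these
  -- determine the third.
  common-neighbour-unique : ∀ u v w x → adjᵛ u v ≡ true →
    adjᵛ u w ≡ true → adjᵛ v w ≡ true → adjᵛ u x ≡ true → adjᵛ v x ≡ true → w ≡ x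
  common-neighbour-unique (row i) (col j) (cell a b) (cell a′ b′) _ uw vw ux vx =
    cong₂ cell (trans (sym (==⇒≡ uw)) (==⇒≡ ux)) (trans (sym (==⇒≡ vw)) (==⇒≡ vx))
  common-neighbour-unique (col j) (row i) (cell a b) (cell a′ b′) _ uw vw ux vx =
    cong₂ cell (trans (sym (==⇒≡ vw)) (==⇒≡ vx)) (trans (sym (==⇒≡ uw)) (==⇒≡ ux))
  common-neighbour-unique (row _) (cell _ _) (col _) (col _) _ _ vw _ vx =
    cong col (trans (sym (==⇒≡ vw)) (==⇒≡ vx))
  common-neighbour-unique (col _) (cell _ _) (row _) (row _) _ _ vw _ vx =
    cong row (trans (sym (==⇒≡ vw)) (==⇒≡ vx))
  common-neighbour-unique (cell _ _) (row _) (col _) (col _) _ uw _ ux _ =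
    cong col (trans (sym (==⇒≡ uw)) (==⇒≡ ux))
  common-neighbour-unique (cell _ _) (col _) (row _) (row _) _ uw _ ux _ =
    cong row (trans (sym (==⇒≡ uw)) (==⇒≡ ux))

  size : ℕ
  size = (N + N) + N * N

  decode : Fin size → Vertex N
  decode x with splitAt (N + N) x
  ... | inj₂ c = uncurry cell (remQuot N c)
  ... | inj₁ l with splitAt N l
  ...   | inj₁ i = row i
  ...   | inj₂ j = col j

  encode : Vertex N → Fin size
  encode (row i)    = (i ↑ˡ N) ↑ˡ (N * N)
  encode (col j)    = (N ↑ʳ j) ↑ˡ (N * N)
  encode (cell a b) = (N + N) ↑ʳ combine a b

  decode-encode : ∀ v → decode (encode v) ≡ v
  decode-encode (row i)
    rewrite splitAt-↑ˡ (N + N) (i ↑ˡ N) (N * N) | splitAt-↑ˡ N i N = refl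
  decode-encode (col j)
    rewrite splitAt-↑ˡ (N + N) (N ↑ʳ j) (N * N) | splitAt-↑ʳ N N j = refl
  decode-encode (cell a b)
    rewrite splitAt-↑ʳ (N + N) (N * N) (combine a b) = cong (uncurry cell) (remQuot-combine a b)

  encode-decode : ∀ x → encode (decode x) ≡ x
  encode-decode x with splitAt (N + N) x in eq
  ... | inj₂ c = trans (cong ((N + N) ↑ʳ_) (combine-remQuot {N} N c)) (splitAt⁻¹-↑ʳ eq)
  ... | inj₁ l with splitAt N l in eq′
  ...   | inj₁ i = trans (cong (_↑ˡ (N * N)) (splitAt⁻¹-↑ˡ eq′)) (splitAt⁻¹-↑ˡ eq)
  ...   | inj₂ j = trans (cong (_↑ˡ (N * N)) (splitAt⁻¹-↑ʳ eq′)) (splitAt⁻¹-↑ˡ eq)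

  decode-injective : ∀ {x y} → decode x ≡ decode y → x ≡ y
  decode-injective {x} {y} eq =
    trans (sym (encode-decode x)) (trans (cong encode eq) (encode-decode y))

  encode-injective : ∀ {u v} → encode u ≡ encode v → u ≡ v
  encode-injective {u} {v} eq =
    trans (sym (decode-encode u)) (trans (cong decode eq) (decode-encode v))

lineGrid : ℕ → Graph
lineGrid N = record
  { n          = size {N}
  ; adj        = λ x y → adjᵛ (decode {N} x) (decode {N} y)
  ; adj-sym    = λ x y → adjᵛ-sym (decode {N} x) (decode {N} y)
  ; adj-irrefl = λ x → adjᵛ-irrefl (decode {N} x)
  }

-- Forbidden induced subgraphs

lineGrid-P₆-free : ∀ N → Free (P 6) (lineGrid N)
lineGrid-P₆-free N (f , f-inj , f-adj) = contradiction
  (trans (sym (f-adj 1F 4F))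
         (lines-P₄-free (inner 0F 1F 2F refl refl refl λ ()) (inner 1F 2F 3F refl refl refl λ ())
                        (inner 2F 3F 4F refl refl refl λ ()) (inner 3F 4F 5F refl refl refl λ ())
                        (f-adj 1F 2F) (f-adj 2F 3F) (f-adj 3F 4F)))
  λ ()
  where
  inner : ∀ x y z → adj (P 6) x y ≡ true → adj (P 6) y z ≡ true → adj (P 6) x z ≡ false →
          x ≢ z → IsLine (decode {N} (f y))
  inner x y z xy yz xz x≢z =
    middle-isLine (decode {N} (f x)) _ (decode {N} (f z))
      (trans (f-adj x y) xy) (trans (f-adj y z) yz) (trans (f-adj x z) xz)
      λ eq → x≢z (f-inj (decode-injective {N} eq))

lineGrid-diamond-free : ∀ N → Free diamond (lineGrid N)
lineGrid-diamond-free N (f , f-inj , f-adj)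
  -- In `diamond`, 2 and 3 come from the `P 2` and are the non-adjacent pair; both are common
  -- neighbours of the adjacent vertices 0 and 1.
  with () ← f-inj {2F} {3F} (decode-injective {N}
              (common-neighbour-unique (decode {N} (f 0F)) (decode {N} (f 1F)) (decode {N} (f 2F)) (decode {N} (f 3F))
                (f-adj 0F 1F) (f-adj 0F 2F) (f-adj 1F 2F) (f-adj 0F 3F) (f-adj 1F 3F)))

-- Cuts with few labels

-- `S` encodes a vertex set together with its labelling: a vertex in the set is sent to its label,
-- any other to `nothing`.
Cut : ∀ {N k} → (Vertex N → Maybe (Fin k)) → Set
Cut S = ∀ {u v w l} → S u ≡ just l → S v ≡ just l → S w ≡ nothing → adjᵛ u w ≡ adjᵛ v w

module _ {N k : ℕ} (S : Vertex N → Maybe (Fin k)) (cut : Cut S) where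

  -- If `u i` and `u j` had the same label, the cut condition would make `w i` a neighbour of `u j`
  -- too, forcing `i ≡ j`. So the selected `u i` use distinct labels.
  private-neighbours : (p : Fin N → Bool) (u w : Fin N → Vertex N) →
    (∀ i → p i ≡ true → is-just (S (u i)) ≡ true) →
    (∀ i → p i ≡ true → S (w i) ≡ nothing) →
    (∀ i → adjᵛ (u i) (w i) ≡ true) →
    (∀ {i j} → adjᵛ (u j) (w i) ≡ true → i ≡ j) →
    count p ≤ k
  private-neighbours p u w u∈ w∉ u~w private′ =
    count-injection p (λ i pi → proj₁ (label i pi)) λ {i} {j} pi pj eq →
      private′ (trans (sym (cut (proj₂ (label i pi))
                                (trans (proj₂ (label j pj)) (cong just (sym eq)))
                                (w∉ i pi)))
                      (u~w i))
    where
    label : ∀ i → p i ≡ true → ∃[ l ] S (u i) ≡ just l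
    label i pi = is-just⇒just (S (u i)) (u∈ i pi)

  rows-in : ℕ
  rows-in = count (λ i → is-just (S (row i)))

  FullRow FullCol : Fin N → Set
  FullRow i = ∀ j → is-just (S (cell i j)) ≡ true
  FullCol j = ∀ i → is-just (S (cell i j)) ≡ true

  missing : (c : Fin N → Vertex N) → ¬ (∀ i → is-just (S (c i)) ≡ true) → ∃[ i ] S (c i) ≡ nothing
  missing c ¬full with ¬∀⟶∃¬ N _ (λ i → is-just (S (c i)) ≟ᵇ true) ¬full
  ... | i , h = i , ≢true⇒nothing _ h

  -- Each row has a cell outside the set, and that cell is adjacent to no other row.
  no-full-row⇒few-rows : (∀ i → ¬ FullRow i) → rows-in ≤ k
  no-full-row⇒few-rows ¬full =
    private-neighbours _ row (λ i → cell i (proj₁ (gap i))) (λ _ → id) (λ i _ → proj₂ (gap i))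
      ==-refl (sym ∘ ==⇒≡)
    where
    gap : ∀ i → ∃[ j ] S (cell i j) ≡ nothing
    gap i = missing (cell i) (¬full i)

  no-full-col⇒few-cols : (∀ j → ¬ FullCol j) → count (λ j → is-just (S (col j))) ≤ k
  no-full-col⇒few-cols ¬full =
    private-neighbours _ col (λ j → cell (proj₁ (gap j)) j) (λ _ → id) (λ j _ → proj₂ (gap j))
      ==-refl (sym ∘ ==⇒≡)
    where
    gap : ∀ j → ∃[ i ] S (cell i j) ≡ nothing
    gap j = missing (λ i → cell i j) (¬full j)

  -- Here the cells of row `i` are the labelled vertices: a column outside the set is adjacent to
  -- exactly one of them.
  full-row⇒few-cols-missing : ∀ i → FullRow i → count (λ j → is-nothing (S (col j))) ≤ k
  full-row⇒few-cols-missing i full =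
    private-neighbours _ (cell i) col (λ j _ → full j) (λ j → is-nothing⇒nothing (S (col j)))
      ==-refl (sym ∘ ==⇒≡)

  full-col⇒few-rows-missing : ∀ j → FullCol j → count (λ i → is-nothing (S (row i))) ≤ k
  full-col⇒few-rows-missing j full =
    private-neighbours _ (λ i → cell i j) row (λ i _ → full i) (λ i → is-nothing⇒nothing (S (row i)))
      ==-refl (sym ∘ ==⇒≡)

  in-or-out : (line : Fin N → Vertex N) →
              N ≤ count (λ i → is-just (S (line i))) + count (λ i → is-nothing (S (line i)))
  in-or-out line = ≤-trans (≤-reflexive (sym (count-true N)))
    (count-cover (const true) _ _ λ i _ → is-just⊎is-nothing (S (line i)))

  few-or-most-rows : k + k < N → rows-in ≤ k ⊎ N ≤ rows-in + k
  few-or-most-rows 2k<N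
    with any? (λ i → all? λ j → is-just (S (cell i j)) ≟ᵇ true)
       | any? (λ j → all? λ i → is-just (S (cell i j)) ≟ᵇ true)
  ... | no ¬full | _ = inj₁ (no-full-row⇒few-rows λ i full → ¬full (i , full))
  ... | yes _ | yes (j , full) =
    inj₂ (≤-trans (in-or-out row) (+-mono-≤ ≤-refl (full-col⇒few-rows-missing j full)))
  -- With a full row but no full column, at most `k` columns are inside and at most `k` outside, so
  -- N would be at most 2k.
  ... | yes (i , full) | no ¬full = ⊥-elim (<⇒≱ 2k<N (≤-trans (in-or-out col)
    (+-mono-≤ (no-full-col⇒few-cols λ j fullⱼ → ¬full (j , fullⱼ)) (full-row⇒few-cols-missing i full))))

-- Subexpressions

module _ {k a b : ℕ} (e₁ : Expr k a) (e₂ : Expr k b) where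

  labels-union-ˡ : ∀ x → labels (union e₁ e₂) (x ↑ˡ b) ≡ labels e₁ x
  labels-union-ˡ x rewrite splitAt-↑ˡ a x b = refl

  labels-union-ʳ : ∀ x → labels (union e₁ e₂) (a ↑ʳ x) ≡ labels e₂ x
  labels-union-ʳ x rewrite splitAt-↑ʳ a b x = refl

  edges-union-ˡˡ : ∀ x y → edges (union e₁ e₂) (x ↑ˡ b) (y ↑ˡ b) ≡ edges e₁ x y
  edges-union-ˡˡ x y rewrite splitAt-↑ˡ a x b | splitAt-↑ˡ a y b = refl

  edges-union-ˡʳ : ∀ x y → edges (union e₁ e₂) (x ↑ˡ b) (a ↑ʳ y) ≡ false
  edges-union-ˡʳ x y rewrite splitAt-↑ˡ a x b | splitAt-↑ʳ a b y = refl

  edges-union-ʳˡ : ∀ x y → edges (union e₁ e₂) (a ↑ʳ x) (y ↑ˡ b) ≡ false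
  edges-union-ʳˡ x y rewrite splitAt-↑ʳ a b x | splitAt-↑ˡ a y b = refl

  edges-union-ʳʳ : ∀ x y → edges (union e₁ e₂) (a ↑ʳ x) (a ↑ʳ y) ≡ edges e₂ x y
  edges-union-ʳʳ x y rewrite splitAt-↑ʳ a b x | splitAt-↑ʳ a b y = refl

labels-relabel : ∀ {k m} (i j : Fin k) (e : Expr k m) {x y} → labels e x ≡ labels e y →
                 labels (relabel i j e) x ≡ labels (relabel i j e) y
labels-relabel i j e {x} {y} eq rewrite eq with labels e y == i
... | true  = refl
... | false = eq

-- `loc` places the vertices of the graph in the subexpression e, with value
-- `nothing` for those that e does not create.
record Embedded {N k m : ℕ} (e : Expr k m) (loc : Vertex N → Maybe (Fin m)) : Set where
  field
    loc-injective : ∀ {u v x} → loc u ≡ just x → loc v ≡ just x → u ≡ v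
    outside : ∀ {u v w x y} → loc u ≡ just x → loc v ≡ just y → labels e x ≡ labels e y →
              loc w ≡ nothing → adjᵛ u w ≡ adjᵛ v w
    inside  : ∀ {u v w x y z} → loc u ≡ just x → loc v ≡ just y → labels e x ≡ labels e y →
              loc w ≡ just z → edges e x z ≡ edges e y z → adjᵛ u w ≡ adjᵛ v w

open Embedded

module _ {N : ℕ} where

  -- Relabelling may merge label classes but never splits one, and it leaves the edges alone.
  embedded-relabel : ∀ {k m} {i j : Fin k} {e : Expr k m} {loc : Vertex N → Maybe (Fin m)} →
                     Embedded (relabel i j e) loc → Embedded e loc
  embedded-relabel {i = i} {j} {e} E = record
    { loc-injective = loc-injective E
    ; outside = λ u v eq w → outside E u v (labels-relabel i j e eq) w
    ; inside  = λ u v eq w → inside E u v (labels-relabel i j e eq) w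
    }

  -- Whether a join adds an edge depends only on the labels of its ends, so equally labelled
  -- vertices that agree towards `z` before the join agree after it. Since joins may still add
  -- edges, `inside` compares edges of `e` with each other and not with the graph.
  embedded-join : ∀ {k m} {i j : Fin k} {i≢j : i ≢ j} {e : Expr k m} {loc : Vertex N → Maybe (Fin m)} →
                  Embedded (join i j i≢j e) loc → Embedded e loc
  embedded-join {i = i} {j} {e = e} E = record
    { loc-injective = loc-injective E
    ; outside = outside E
    ; inside  = λ {_} {_} {_} {_} {_} {z} u v eq w ee → inside E u v eq w
        (cong₂ (λ d l → d ∨ ((l == i) ∧ (labels e z == j)) ∨ ((l == j) ∧ (labels e z == i))) ee eq)
    }

  module _ {k a b : ℕ} (e₁ : Expr k a) (e₂ : Expr k b) (loc : Vertex N → Maybe (Fin (a + b))) where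

    -- Vertices created by the other operand count as outside this one.
    locˡ : Vertex N → Maybe (Fin a)
    locˡ u = loc u >>= (isInj₁ ∘ splitAt a)

    locʳ : Vertex N → Maybe (Fin b)
    locʳ u = loc u >>= (isInj₂ ∘ splitAt a)

    locˡ-just : ∀ u {x} → locˡ u ≡ just x → loc u ≡ just (x ↑ˡ b)
    locˡ-just u eq with loc u
    ... | just s with splitAt a s in split
    ...   | inj₁ y with refl ← eq = cong just (sym (splitAt⁻¹-↑ˡ split))

    locʳ-just : ∀ u {x} → locʳ u ≡ just x → loc u ≡ just (a ↑ʳ x)
    locʳ-just u eq with loc u
    ... | just s with splitAt a s in split
    ...   | inj₂ y with refl ← eq = cong just (sym (splitAt⁻¹-↑ʳ split))

    locˡ-nothing : ∀ u → locˡ u ≡ nothing → loc u ≡ nothing ⊎ ∃[ z ] loc u ≡ just (a ↑ʳ z)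
    locˡ-nothing u eq with loc u
    ... | nothing = inj₁ refl
    ... | just s with splitAt a s in split
    ...   | inj₂ y = inj₂ (y , cong just (sym (splitAt⁻¹-↑ʳ split)))

    locʳ-nothing : ∀ u → locʳ u ≡ nothing → loc u ≡ nothing ⊎ ∃[ z ] loc u ≡ just (z ↑ˡ b)
    locʳ-nothing u eq with loc u
    ... | nothing = inj₁ refl
    ... | just s with splitAt a s in split
    ...   | inj₁ y = inj₂ (y , cong just (sym (splitAt⁻¹-↑ˡ split)))

    loc-split : ∀ u → is-just (loc u) ≡ true → is-just (locˡ u) ≡ true ⊎ is-just (locʳ u) ≡ true
    loc-split u h with loc u
    ... | just s with splitAt a s
    ...   | inj₁ _ = inj₁ refl
    ...   | inj₂ _ = inj₂ refl

    embedded-unionˡ : Embedded (union e₁ e₂) loc → Embedded e₁ locˡ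
    embedded-unionˡ E = record
      { loc-injective = λ {u} {v} lu lv → loc-injective E (locˡ-just u lu) (locˡ-just v lv)
      ; outside = out
      ; inside  = λ {u} {v} {w} {x} {y} {z} lu lv eq lw ee →
          inside E (locˡ-just u lu) (locˡ-just v lv) (lift eq) (locˡ-just w lw)
            (trans (edges-union-ˡˡ e₁ e₂ x z) (trans ee (sym (edges-union-ˡˡ e₁ e₂ y z))))
      }
      where
      lift : ∀ {x y} → labels e₁ x ≡ labels e₁ y →
             labels (union e₁ e₂) (x ↑ˡ b) ≡ labels (union e₁ e₂) (y ↑ˡ b)
      lift {x} {y} eq = trans (labels-union-ˡ e₁ e₂ x) (trans eq (sym (labels-union-ˡ e₁ e₂ y)))
      out : ∀ {u v w x y} → locˡ u ≡ just x → locˡ v ≡ just y → labels e₁ x ≡ labels e₁ y →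
            locˡ w ≡ nothing → adjᵛ u w ≡ adjᵛ v w
      out {u} {v} {w} {x} {y} lu lv eq lw with locˡ-nothing w lw
      ... | inj₁ w∉       = outside E (locˡ-just u lu) (locˡ-just v lv) (lift eq) w∉
      -- A vertex `w` of the other operand has no edge across the union, so `u` and `v` agree
      -- towards it and `inside` applies.
      ... | inj₂ (z , wz) = inside E (locˡ-just u lu) (locˡ-just v lv) (lift eq) wz
            (trans (edges-union-ˡʳ e₁ e₂ x z) (sym (edges-union-ˡʳ e₁ e₂ y z)))

    embedded-unionʳ : Embedded (union e₁ e₂) loc → Embedded e₂ locʳ
    embedded-unionʳ E = record
      { loc-injective = λ {u} {v} lu lv → loc-injective E (locʳ-just u lu) (locʳ-just v lv)
      ; outside = out
      ; inside  = λ {u} {v} {w} {x} {y} {z} lu lv eq lw ee →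
          inside E (locʳ-just u lu) (locʳ-just v lv) (lift eq) (locʳ-just w lw)
            (trans (edges-union-ʳʳ e₁ e₂ x z) (trans ee (sym (edges-union-ʳʳ e₁ e₂ y z))))
      }
      where
      lift : ∀ {x y} → labels e₂ x ≡ labels e₂ y →
             labels (union e₁ e₂) (a ↑ʳ x) ≡ labels (union e₁ e₂) (a ↑ʳ y)
      lift {x} {y} eq = trans (labels-union-ʳ e₁ e₂ x) (trans eq (sym (labels-union-ʳ e₁ e₂ y)))
      out : ∀ {u v w x y} → locʳ u ≡ just x → locʳ v ≡ just y → labels e₂ x ≡ labels e₂ y →
            locʳ w ≡ nothing → adjᵛ u w ≡ adjᵛ v w
      out {u} {v} {w} {x} {y} lu lv eq lw with locʳ-nothing w lw
      ... | inj₁ w∉       = outside E (locʳ-just u lu) (locʳ-just v lv) (lift eq) w∉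
      ... | inj₂ (z , wz) = inside E (locʳ-just u lu) (locʳ-just v lv) (lift eq) wz
            (trans (edges-union-ʳˡ e₁ e₂ x z) (sym (edges-union-ʳˡ e₁ e₂ y z)))

  -- Rows created by a subexpression

  rows-created : ∀ {m} → (Vertex N → Maybe (Fin m)) → ℕ
  rows-created loc = count (λ i → is-just (loc (row i)))

  rows-created≤size : ∀ {k m} {e : Expr k m} {loc : Vertex N → Maybe (Fin m)} →
                      Embedded e loc → rows-created loc ≤ m
  rows-created≤size {m = m} {loc = loc} E =
    count-injection _ (λ i pi → proj₁ (at i pi)) λ {i} {j} pi pj eq →
      row-injective (loc-injective E (proj₂ (at i pi)) (trans (proj₂ (at j pj)) (cong just (sym eq))))
    where
    at : ∀ i → is-just (loc (row i)) ≡ true → ∃[ x ] loc (row i) ≡ just x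
    at i = is-just⇒just (loc (row i))
    row-injective : ∀ {i j : Fin N} → _≡_ {A = Vertex N} (row i) (row j) → i ≡ j
    row-injective refl = refl

  embedded-cut : ∀ {k m} {e : Expr k m} {loc : Vertex N → Maybe (Fin m)} →
                 Embedded e loc → Cut (mapᴹ (labels e) ∘ loc)
  embedded-cut {loc = loc} E {u} {v} {w} lu lv lw
    with map-just⁻¹ (loc u) lu | map-just⁻¹ (loc v) lv
  ... | x , ux , lx | y , vy , ly = outside E ux vy (trans lx (sym ly)) (map-nothing⁻¹ (loc w) lw)

  embedded-few-or-most : ∀ {k m} {e : Expr k m} {loc : Vertex N → Maybe (Fin m)} → Embedded e loc →
                         k + k < N → rows-created loc ≤ k ⊎ N ≤ rows-created loc + k
  embedded-few-or-most {k} {e = e} {loc} E 2k<N =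
    subst (λ c → c ≤ k ⊎ N ≤ c + k) (count-cong λ i → is-just-map (loc (row i)))
      (few-or-most-rows (mapᴹ (labels e) ∘ loc) (embedded-cut E) 2k<N)

  -- Induction on the expression. Joins and relabellings create no vertices, so only a union needs
  -- the dichotomy.
  embedded-few : ∀ {k m} (e : Expr k m) {loc : Vertex N → Maybe (Fin m)} → Embedded e loc →
                 k + k + k < N → rows-created loc ≤ k
  embedded-few ∅ E _ = ≤-trans (rows-created≤size E) z≤n
  -- The label `i` witnesses that there is at least one label, which covers the single vertex.
  embedded-few {suc k} (vertex i) E _ = ≤-trans (rows-created≤size E) (s≤s z≤n)
  embedded-few (join i j i≢j e) E 3k<N = embedded-few e (embedded-join E) 3k<N
  embedded-few (relabel i j e) E 3k<N = embedded-few e (embedded-relabel E) 3k<N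
  embedded-few {k} (union e₁ e₂) {loc} E 3k<N
    with embedded-few-or-most E (≤-trans (s≤s (m≤m+n (k + k) k)) 3k<N)
  ... | inj₁ few  = few
  ... | inj₂ most = ⊥-elim (<⇒≱ 3k<N (≤-trans most (+-monoˡ-≤ k
          (≤-trans (count-cover _ _ _ λ i → loc-split e₁ e₂ loc (row i))
            (+-mono-≤ (embedded-few e₁ (embedded-unionˡ e₁ e₂ loc E) 3k<N)
                      (embedded-few e₂ (embedded-unionʳ e₁ e₂ loc E) 3k<N))))))

-- Lower bound on clique-width

lineGrid-cliquewidth : ∀ {N k} → k + k + k < N → ¬ CWAtMost k (lineGrid N)
lineGrid-cliquewidth {N} {k} 3k<N (e , b , b-edges) =
  -- The whole expression creates all N rows, so N would be at most `k`.
  <⇒≱ (≤-trans (s≤s (m≤n+m k (k + k))) 3k<N)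
      (subst (_≤ k) (count-true N) (embedded-few e root 3k<N))
  where
  loc : Vertex N → Maybe (Fin (size {N}))
  loc u = just (Bijection.to b (encode u))
  edges-loc : ∀ {u w x z} → loc u ≡ just x → loc w ≡ just z → edges e x z ≡ adjᵛ u w
  edges-loc {u} {w} refl refl =
    trans (b-edges (encode u) (encode w)) (cong₂ adjᵛ (decode-encode u) (decode-encode w))
  root : Embedded e loc
  root = record
    { loc-injective = λ lu lv → encode-injective (Bijection.injective b (just-injective (trans lu (sym lv))))
    ; outside = λ _ _ _ ()
    ; inside  = λ {u} {v} {w} lu lv _ lw ee →
        trans (sym (edges-loc {u} {w} lu lw)) (trans ee (edges-loc {v} {w} lv lw))
    }

theorem4 : UnboundedCW (λ G → Free (P 6) G × Free diamond G)
theorem4 c = lineGrid N , (lineGrid-P₆-free N , lineGrid-diamond-free N) , lineGrid-cliquewidth (n<1+n (c + c + c))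
  where
  N : ℕ
  -- The least N above 3c.
  N = suc (c + c + c)
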